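{- Let $\mu$ be a partition of $n$ and let $x_2^{\alpha_2}\cdots x_n^{\alpha_n}\in\mathcal{A}(\mu)$ be a monomial of degree $r$. Run the following procedure: set $\rho^{(n)}=\mu$; for $i=n,n-1,\dots,2$, impose the dimension-ordering on the current composition $\rho^{(i)}$, place the number $i$ in the box with dimension-order label $\alpha_i+1$, and delete that box to obtain a composition $\rho^{(i-1)}$ of $i-1$; finally place $1$ in the one remaining box, and let $T$ be the resulting filling of $\mu$ (all placed numbers restored). Then at every step the box with label $\alpha_i+1$ exists, $T$ is a row-strict filling of $\mu$ with exactly $r$ dimension pairs, and $\Phi(T)=x_2^{\alpha_2}\cdots x_n^{\alpha_n}$. Consequently, setting $\Psi(x^\alpha):=T$ defines a degree-preserving map $\Psi$ from $\mathcal{A}(\mu)$ to row-strict fillings of $\mu$ with $\Phi\circ\Psi=\mathrm{id}_{\mathcal{A}(\mu)}$.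
   Context: A composition $\rho$ of $n$ is a sequence of nonnegative integers summing to $n$, drawn with $\rho_k$ left-justified boxes in row $k$ (rows top to bottom, columns left to right); a partition is a weakly decreasing composition with positive parts. A filling places $1,\dots,n$ bijectively in the boxes; row-strict means entries increase left to right in each row. Dimension-ordering of a composition with $r$ nonzero rows: the far-right boxes of the nonzero rows are labelled $1,\dots,r$ in the order obtained by sorting them by column from rightmost column to leftmost, and within a column from top to bottom. Dimension pairs (with $h(j)=j$): $(a,b)$ is a dimension pair of a filling $T$ if (1) $b>a$; (2) $b$ lies in the same column as $a$ strictly below it, or in a column strictly left of $a$'s; (3) if a box immediately right of $a$ exists, containing $c$, then $b\le c$. $D^T_j$ is the set of dimension pairs $(a,j)$; $\Phi(T)=\prod_{j=2}^n x_j^{|D^T_j|}$. $\mathcal{A}(\mu)=\{\Phi(T): T \text{ a row-strict filling of }\mu\}$. -}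

module Defs where

open import Data.Fin.Base as Fin using (Fin; zero; suc)
import Data.Fin.Properties as Fin
open import Data.List.Base as List
  using (List; []; _∷_; length; filter; allFin; cartesianProduct; concatMap; applyUpTo; head; drop)
import Data.List.Sort.InsertionSort as InsertionSort
open import Data.List.Membership.Propositional using (_∈_)
open import Data.Maybe.Base using (Maybe; nothing; just; _>>=_)
open import Data.Nat.Base using (ℕ; zero; suc; pred; _≤_; _<_; _>_; _≥_)
open import Data.Nat.Properties as ℕ using (≤-decTotalOrder)
open import Data.Product.Base using (Σ; ∃; _×_; _,_; proj₁; proj₂)
open import Data.Product.Relation.Binary.Lex.NonStrict using (×-decTotalOrder)
open import Data.Sum.Base using (_⊎_)
open import Data.Vec.Base using (Vec; []; _∷ʳ_; lookup; tabulate; sum; init; last; _[_]%=_)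
open import Data.Vec.Relation.Unary.All using (All)
open import Data.Vec.Relation.Unary.Linked using (Linked)
open import Level using (0ℓ)
open import Relation.Binary.Bundles using (DecTotalOrder)
import Relation.Binary.Construct.Flip.EqAndOrd as Flip
open import Relation.Binary.Definitions using (Decidable)
open import Relation.Binary.PropositionalEquality using (_≡_)
open import Relation.Nullary.Decidable using (_×-dec_; _⊎-dec_; _→-dec_)

-- A composition with ℓ rows; zero rows are allowed and keep their place.
Composition : ℕ → Set
Composition ℓ = Vec ℕ ℓ

record IsPartition {ℓ} (n : ℕ) (μ : Composition ℓ) : Set where
  field
    positive   : All (_> 0) μ
    decreasing : Linked _≥_ μ
    total      : sum μ ≡ n

-- A box is a pair (column , row).  Columns count from 1; rows are
-- elements of Fin ℓ, increasing from top to bottom.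
Box : ℕ → Set
Box ℓ = ℕ × Fin ℓ

column : ∀ {ℓ} → Box ℓ → ℕ
column = proj₁

row : ∀ {ℓ} → Box ℓ → Fin ℓ
row = proj₂

boxes : ∀ {ℓ} → Composition ℓ → List (Box ℓ)
boxes ρ = concatMap (λ k → applyUpTo (λ c → suc c , k) (lookup ρ k)) (allFin _)

-- A placement of 1, …, n: the element a of Fin n stands for the number
-- suc (toℕ a), and lookup T a is the box that contains this number.
Placement : ℕ → ℕ → Set
Placement n ℓ = Vec (Box ℓ) n

record IsFilling {n ℓ} (ρ : Composition ℓ) (T : Placement n ℓ) : Set where
  field
    inside     : ∀ a → lookup T a ∈ boxes ρ
    injective  : ∀ {a b} → lookup T a ≡ lookup T b → a ≡ b
    surjective : ∀ {p} → p ∈ boxes ρ → ∃ λ a → lookup T a ≡ p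

RowStrict : ∀ {n ℓ} → Placement n ℓ → Set
RowStrict T = ∀ a b → row (lookup T a) ≡ row (lookup T b) →
              column (lookup T a) < column (lookup T b) → a Fin.< b

record RowStrictFilling {ℓ} (n : ℕ) (μ : Composition ℓ) : Set where
  field
    placement : Placement n ℓ
    isFilling : IsFilling μ placement
    rowStrict : RowStrict placement

BelowOrLeft : ∀ {ℓ} → Box ℓ → Box ℓ → Set
BelowOrLeft q p = (column q ≡ column p × row p Fin.< row q) ⊎ column q < column p

ImmediatelyRight : ∀ {ℓ} → Box ℓ → Box ℓ → Set
ImmediatelyRight q p = row q ≡ row p × column q ≡ suc (column p)

DimensionPair : ∀ {n ℓ} → Placement n ℓ → Fin n → Fin n → Set
DimensionPair T a b =
  a Fin.< b
  × BelowOrLeft (lookup T b) (lookup T a)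
  × (∀ c → ImmediatelyRight (lookup T c) (lookup T a) → b Fin.≤ c)

dimensionPair? : ∀ {n ℓ} (T : Placement n ℓ) → Decidable (DimensionPair T)
dimensionPair? T a b =
  a Fin.<? b
  ×-dec ((column (lookup T b) ℕ.≟ column (lookup T a)
            ×-dec row (lookup T a) Fin.<? row (lookup T b))
         ⊎-dec column (lookup T b) ℕ.<? column (lookup T a))
  ×-dec Fin.all? λ c →
          (row (lookup T c) Fin.≟ row (lookup T a)
            ×-dec column (lookup T c) ℕ.≟ suc (column (lookup T a)))
          →-dec b Fin.≤? c

dimensionPairs : ∀ {n ℓ} → Placement n ℓ → List (Fin n × Fin n)
dimensionPairs T =
  filter (λ (a , b) → dimensionPair? T a b) (cartesianProduct (allFin _) (allFin _))

-- The set D^T_j, given by the first components of its pairs.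
D : ∀ {n ℓ} → Placement n ℓ → Fin n → List (Fin n)
D T j = filter (λ a → dimensionPair? T a j) (allFin _)

-- A monomial in x₂, …, xₙ is its vector (α₂ , … , αₙ) of exponents.
Monomial : ℕ → Set
Monomial n = Vec ℕ (pred n)

degree : ∀ n → Monomial n → ℕ
degree _ = sum

-- The number j ∈ {2, …, n} that indexes the i-th variable, as an element of Fin n.
variableIndex : ∀ {n} → Fin (pred n) → Fin n
variableIndex {suc n} i = suc i

Φ : ∀ {n ℓ} → Placement n ℓ → Monomial n
Φ T = tabulate λ i → length (D T (variableIndex i))

𝒜 : ∀ n {ℓ} → Composition ℓ → Monomial n → Set
𝒜 n μ α = Σ (RowStrictFilling n μ) λ T → Φ (RowStrictFilling.placement T) ≡ α

farRightBoxes : ∀ {ℓ} → Composition ℓ → List (Box ℓ)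
farRightBoxes ρ =
  List.map (λ k → lookup ρ k , k) (filter (λ k → 0 ℕ.<? lookup ρ k) (allFin _))

-- Lexicographic on (column , row), with the order on columns reversed.
dimensionOrder : ℕ → DecTotalOrder 0ℓ 0ℓ 0ℓ
dimensionOrder ℓ = ×-decTotalOrder (Flip.decTotalOrder ≤-decTotalOrder) (Fin.≤-decTotalOrder ℓ)

dimensionOrdering : ∀ {ℓ} → Composition ℓ → List (Box ℓ)
dimensionOrdering {ℓ} ρ = InsertionSort.sort (dimensionOrder ℓ) (farRightBoxes ρ)

-- Labels start at 1, so the box labelled suc i is at position i of the list.
boxLabelled : ∀ {ℓ} → ℕ → Composition ℓ → Maybe (Box ℓ)
boxLabelled zero    ρ = nothing
boxLabelled (suc i) ρ = head (drop i (dimensionOrdering ρ))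

-- Only far-right boxes are ever deleted.
deleteBox : ∀ {ℓ} → Box ℓ → Composition ℓ → Composition ℓ
deleteBox p ρ = ρ [ row p ]%= pred

remainingBox : ∀ {ℓ} → Composition ℓ → Maybe (Box ℓ)
remainingBox ρ with boxes ρ
... | p ∷ [] = just p
... | _      = nothing

-- procedure i α ρ runs the steps i, i - 1, …, 1 from ρ^(i) = ρ, with
-- α = (α₂ , … , αᵢ).  It yields nothing exactly when some step asks for a
-- label that does not occur, or no unique box is left for the number 1.
-- The case i = 0 is only the empty filling of the empty partition.
procedure : ∀ i {ℓ} → Monomial i → Composition ℓ → Maybe (Placement i ℓ)
procedure 0             α ρ = just []
procedure 1             α ρ = remainingBox ρ >>= λ p → just ([] ∷ʳ p)
procedure (suc (suc i)) α ρ =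
  boxLabelled (suc (last α)) ρ                      >>= λ p →
  procedure (suc i) (init α) (deleteBox p ρ)        >>= λ T →
  just (T ∷ʳ p)

{-# OPTIONS --safe #-}

-- For a row-strict filling T the entries 1, …, j occupy a left-justified shape
-- ρ^(j), in which j lies at the end of its row.  Condition (3) says that the
-- a with (a, j) a dimension pair are exactly the far-right entries of ρ^(j) whose
-- boxes precede that of j in the dimension-ordering.  So j carries the label
-- |D^T_j| + 1 in ρ^(j), and the procedure run on Φ(T) rebuilds T itself.

module Submission where

open import Defs
open import Data.Fin.Base as Fin using (Fin; zero; suc; fromℕ; inject₁)
import Data.Fin.Properties as Fin
open import Data.Fin.Relation.Unary.Top using (view; ‵fromℕ; ‵inject₁)
open import Data.List.Base as List
  using (List; []; _∷_; length; filter; allFin; cartesianProduct; concatMap; applyUpTo; head; drop)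
open import Data.List.Properties
  using (length-map; length-++; filter-none; filter-accept; filter-reject)
open import Data.List.Membership.Propositional using (_∈_; _∉_; find; lose)
open import Data.List.Membership.Propositional.Properties
open import Data.List.Membership.Propositional.Properties.WithK using (unique∧set⇒bag)
open import Data.List.Relation.Binary.BagAndSetEquality using (∼bag⇒↭)
open import Data.List.Relation.Binary.Permutation.Propositional using (_↭_; ↭-sym; ↭⇒↭ₛ)
open import Data.List.Relation.Binary.Permutation.Propositional.Properties
  using (∈-resp-↭; ↭-length; ↭-singleton-inv)
import Data.List.Relation.Binary.Permutation.Setoid.Properties as SetoidPermutation
open import Data.List.Relation.Unary.All as All using (All; []; _∷_)
import Data.List.Relation.Unary.All.Properties as All
open import Data.List.Relation.Unary.AllPairs as AllPairs using (AllPairs; []; _∷_)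
import Data.List.Relation.Unary.AllPairs.Properties as AllPairs
open import Data.List.Relation.Unary.Any using (here; there)
open import Data.List.Relation.Unary.Sorted.TotalOrder.Properties using (Sorted⇒AllPairs)
open import Data.List.Relation.Unary.Unique.Propositional using (Unique)
import Data.List.Relation.Unary.Unique.Propositional.Properties as Unique
import Data.List.Sort.Base
open import Data.List.Sort.InsertionSort using (insertionSort)
open import Data.Maybe.Base using (just)
open import Data.Nat.Base using (ℕ; zero; suc; pred; _+_; _≤_; _<_; z≤n; s≤s)
import Data.Nat.Properties as ℕ
open import Data.Product.Base using (Σ; _×_; ∃; _,_; proj₁; proj₂)
open import Data.Sum.Base using (inj₁; inj₂)
open import Data.Vec.Base as Vec using ([]; _∷_; _∷ʳ_; lookup; initLast)
open import Data.Vec.Properties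
  using (init-∷ʳ; last-∷ʳ; lookup∘updateAt; lookup∘updateAt′; tabulate-cong)
open import Function.Base using (_∘_; id)
open import Function.Bundles using (mk⇔)
open import Relation.Binary.Bundles using (DecTotalOrder)
open import Relation.Binary.Definitions using (Decidable; Irreflexive; Asymmetric)
open import Relation.Binary.PropositionalEquality
open import Relation.Nullary using (yes; no; contradiction)
open import Relation.Nullary.Decidable using (_×-dec_; _⊎-dec_)

private
  variable
    A B : Set
    m n ℓ : ℕ

-- Lists and vectors

unique∧set⇒↭ : ∀ {xs ys : List A} → Unique xs → Unique ys →
               (∀ {x} → x ∈ xs → x ∈ ys) → (∀ {x} → x ∈ ys → x ∈ xs) → xs ↭ ys
unique∧set⇒↭ xs! ys! to from = ∼bag⇒↭ (unique∧set⇒bag xs! ys! (mk⇔ to from))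

-- Cardinalities are compared up to order: an injective image of `xs` with the same members as `ys`
-- is a permutation of `ys`, both lists being free of repetitions.
length-bijection : ∀ {f : A → B} {xs ys} → Unique xs → Unique ys →
                   (∀ {x y} → f x ≡ f y → x ≡ y) →
                   (∀ {x} → x ∈ xs → f x ∈ ys) →
                   (∀ {y} → y ∈ ys → ∃ λ x → x ∈ xs × y ≡ f x) →
                   length xs ≡ length ys
length-bijection {f = f} {xs} {ys} xs! ys! f-inj to from =
  trans (sym (length-map f xs))
        (↭-length (unique∧set⇒↭ (Unique.map⁺ f-inj xs!) ys! to′ from′))
  where
  to′ : ∀ {y} → y ∈ List.map f xs → y ∈ ys
  to′ y∈ with _ , x∈ , refl ← ∈-map⁻ f y∈ = to x∈

  from′ : ∀ {y} → y ∈ ys → y ∈ List.map f xs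
  from′ y∈ with _ , x∈ , refl ← from y∈ = ∈-map⁺ f x∈

-- Since `g` recovers from an element the index of its block, blocks of distinct indices are
-- disjoint.
concatMap-unique : ∀ (f : A → List B) (g : B → A) {xs} →
                   (∀ x → Unique (f x)) → (∀ {x y} → y ∈ f x → g y ≡ x) →
                   Unique xs → Unique (concatMap f xs)
concatMap-unique f g f! fibre xs! =
  Unique.concat⁺ (All.map⁺ (All.universal f! _))
    (AllPairs.map⁺ (AllPairs.map
      (λ x≢y {_} (z∈x , z∈y) → x≢y (trans (sym (fibre z∈x)) (fibre z∈y))) xs!))

length-concatMap-tabulate : ∀ (f : A → List B) (h : Fin n → A) →
  length (concatMap f (List.tabulate h)) ≡ Vec.sum (Vec.tabulate (length ∘ f ∘ h))
length-concatMap-tabulate {n = zero}  f h = refl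
length-concatMap-tabulate {n = suc n} f h =
  trans (length-++ (f (h zero)))
        (cong (length (f (h zero)) +_) (length-concatMap-tabulate f (h ∘ suc)))

module _ {_≺_ : A → A → Set} (_≺?_ : Decidable _≺_)
         (irrefl : Irreflexive _≡_ _≺_) (asym : Asymmetric _≺_) where

  -- In a strictly sorted list the elements smaller than `p` are exactly those standing before it,
  -- so their number is the position of `p`, counted from 0.
  head-drop-predecessors : ∀ {xs p} → AllPairs _≺_ xs → p ∈ xs →
    head (drop (length (filter (_≺? p) xs)) xs) ≡ just p
  head-drop-predecessors {x ∷ xs} (x≺xs ∷ _) (here refl)
    rewrite filter-reject (_≺? x) {xs = xs} (irrefl refl)
          | filter-none (_≺? x) (All.map asym x≺xs) = refl
  head-drop-predecessors {x ∷ xs} {p} (x≺xs ∷ xs≺) (there p∈xs)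
    rewrite filter-accept (_≺? p) {xs = xs} (All.lookup x≺xs p∈xs) =
    head-drop-predecessors xs≺ p∈xs

lookup-∷ʳ-inject₁ : ∀ (xs : Vec.Vec A n) x i → lookup (xs ∷ʳ x) (inject₁ i) ≡ lookup xs i
lookup-∷ʳ-inject₁ (_ ∷ _)  x zero    = refl
lookup-∷ʳ-inject₁ (_ ∷ xs) x (suc i) = lookup-∷ʳ-inject₁ xs x i

lookup-∷ʳ-fromℕ : ∀ (xs : Vec.Vec A n) x → lookup (xs ∷ʳ x) (fromℕ n) ≡ x
lookup-∷ʳ-fromℕ []       x = refl
lookup-∷ʳ-fromℕ (_ ∷ xs) x = lookup-∷ʳ-fromℕ xs x

tabulate-∷ʳ : ∀ (f : Fin (suc n) → A) →
              Vec.tabulate f ≡ Vec.tabulate (f ∘ inject₁) ∷ʳ f (fromℕ n)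
tabulate-∷ʳ {n = zero}  f = refl
tabulate-∷ʳ {n = suc n} f = cong (f zero ∷_) (tabulate-∷ʳ (f ∘ suc))

-- Boxes and the dimension-ordering

rowBoxes : Composition ℓ → Fin ℓ → List (Box ℓ)
rowBoxes ρ k = applyUpTo (λ c → suc c , k) (lookup ρ k)

∈-rowBoxes⁻ : ∀ (ρ : Composition ℓ) {q k} → q ∈ rowBoxes ρ k →
              0 < column q × column q ≤ lookup ρ k × row q ≡ k
∈-rowBoxes⁻ ρ {k = k} q∈ with _ , i<ρₖ , refl ← ∈-applyUpTo⁻ (λ c → suc c , k) q∈ =
  s≤s z≤n , i<ρₖ , refl

∈-boxes⁺ : ∀ (ρ : Composition ℓ) {c k} → 0 < c → c ≤ lookup ρ k → (c , k) ∈ boxes ρ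
∈-boxes⁺ ρ {suc _} {k} _ c≤ρₖ =
  ∈-concatMap⁺ (rowBoxes ρ) (lose (∈-allFin k) (∈-applyUpTo⁺ _ c≤ρₖ))

∈-boxes⁻ : ∀ (ρ : Composition ℓ) {c k} → (c , k) ∈ boxes ρ → 0 < c × c ≤ lookup ρ k
∈-boxes⁻ ρ q∈
  with _ , _ , q∈row ← find (∈-concatMap⁻ (rowBoxes ρ) {xs = allFin _} q∈)
  with 0<c , c≤ρₖ , refl ← ∈-rowBoxes⁻ ρ q∈row = 0<c , c≤ρₖ

boxes-unique : ∀ (ρ : Composition ℓ) → Unique (boxes ρ)
boxes-unique ρ = concatMap-unique (rowBoxes ρ) row
  (λ k → Unique.applyUpTo⁺₁ _ _ λ i<j _ eq → ℕ.<⇒≢ i<j (ℕ.suc-injective (cong column eq)))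
  (λ q∈row → proj₂ (proj₂ (∈-rowBoxes⁻ ρ q∈row)))
  (Unique.allFin⁺ _)

infix 4 _≺_ _≺?_

-- Condition (2) on dimension pairs with its arguments swapped is the strict form of the
-- dimension-ordering. This is what ties dimension pairs to labels.
_≺_ : Box ℓ → Box ℓ → Set
q ≺ p = BelowOrLeft p q

_≺?_ : Decidable (_≺_ {ℓ})
q ≺? p = (column p ℕ.≟ column q ×-dec row q Fin.<? row p) ⊎-dec column p ℕ.<? column q

≺-irrefl : Irreflexive _≡_ (_≺_ {ℓ})
≺-irrefl refl (inj₁ (_ , r<r)) = ℕ.<-irrefl refl r<r
≺-irrefl refl (inj₂ c<c)       = ℕ.<-irrefl refl c<c

≺-asym : Asymmetric (_≺_ {ℓ})
≺-asym (inj₁ (_ , r<)) (inj₁ (_ , r>)) = ℕ.<-asym r< r>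
≺-asym (inj₁ (eq , _)) (inj₂ c<)       = ℕ.<-irrefl (sym eq) c<
≺-asym (inj₂ c<)       (inj₁ (eq , _)) = ℕ.<-irrefl (sym eq) c<
≺-asym (inj₂ c<)       (inj₂ c>)       = ℕ.<-asym c< c>

≤∧≢⇒≺ : ∀ {q p : Box ℓ} → DecTotalOrder._≤_ (dimensionOrder ℓ) q p → q ≢ p → q ≺ p
≤∧≢⇒≺ (inj₁ (c≤ , c≢))   q≢p = inj₂ (ℕ.≤∧≢⇒< c≤ (c≢ ∘ sym))
≤∧≢⇒≺ (inj₂ (refl , r≤)) q≢p = inj₁ (refl , Fin.≤∧≢⇒< r≤ (q≢p ∘ cong (_ ,_)))

module _ {ℓ} (ρ : Composition ℓ) where

  open Data.List.Sort.Base.SortingAlgorithm (insertionSort (dimensionOrder ℓ))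
    using (sort-↭; sort-↗)

  ∈-dimensionOrdering⁺ : ∀ {c k} → c ≡ lookup ρ k → 0 < c → (c , k) ∈ dimensionOrdering ρ
  ∈-dimensionOrdering⁺ {k = k} refl 0<c = ∈-resp-↭ (↭-sym (sort-↭ (farRightBoxes ρ)))
    (∈-map⁺ _ (∈-filter⁺ (λ k → 0 ℕ.<? lookup ρ k) (∈-allFin k) 0<c))

  ∈-dimensionOrdering⁻ : ∀ {c k} → (c , k) ∈ dimensionOrdering ρ → c ≡ lookup ρ k × 0 < c
  ∈-dimensionOrdering⁻ q∈
    with _ , k∈ , refl ← ∈-map⁻ _ (∈-resp-↭ (sort-↭ (farRightBoxes ρ)) q∈) =
    refl , proj₂ (∈-filter⁻ (λ k → 0 ℕ.<? lookup ρ k) {xs = allFin ℓ} k∈)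

  -- Each row contributes at most one far-right box, so the row tells boxes apart; sorting merely
  -- permutes them.
  dimensionOrdering-unique : Unique (dimensionOrdering ρ)
  dimensionOrdering-unique =
    SetoidPermutation.Unique-resp-↭ (setoid _) (↭⇒↭ₛ (↭-sym (sort-↭ (farRightBoxes ρ))))
      (Unique.map⁺ (cong row) (Unique.filter⁺ _ (Unique.allFin⁺ ℓ)))

  -- Sorting yields only the weak order; the absence of repetitions makes it strict.
  dimensionOrdering-≺ : AllPairs _≺_ (dimensionOrdering ρ)
  dimensionOrdering-≺ = AllPairs.zipWith (λ (q≤p , q≢p) → ≤∧≢⇒≺ q≤p q≢p)
    ( Sorted⇒AllPairs (DecTotalOrder.totalOrder (dimensionOrder ℓ)) (sort-↗ (farRightBoxes ρ))
    , dimensionOrdering-unique )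

  boxLabelled-predecessors : ∀ {p} → p ∈ dimensionOrdering ρ →
    boxLabelled (suc (length (filter (_≺? p) (dimensionOrdering ρ)))) ρ ≡ just p
  boxLabelled-predecessors = head-drop-predecessors _≺?_ ≺-irrefl ≺-asym dimensionOrdering-≺

  module _ {p} (p-last : column p ≡ lookup ρ (row p)) where

    -- Decrementing a row length removes the last box of that row; `p-last` says that this box is
    -- `p`.
    ∈-deleteBox⁺ : ∀ {q} → q ∈ boxes ρ → q ≢ p → q ∈ boxes (deleteBox p ρ)
    ∈-deleteBox⁺ {c , k} q∈ q≢p with 0<c , c≤ρₖ ← ∈-boxes⁻ ρ q∈ | k Fin.≟ row p
    ... | yes refl = ∈-boxes⁺ (deleteBox p ρ) 0<c (subst (c ≤_) (sym (lookup∘updateAt k {pred} ρ)) (ℕ.<⇒≤pred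
                       (ℕ.≤∧≢⇒< c≤ρₖ λ c≡ → q≢p (cong (_, k) (trans c≡ (sym p-last))))))
    ... | no k≢    = ∈-boxes⁺ (deleteBox p ρ) 0<c (subst (c ≤_) (sym (lookup∘updateAt′ k _ {pred} k≢ ρ)) c≤ρₖ)

    ∈-deleteBox⁻ : ∀ {q} → q ∈ boxes (deleteBox p ρ) → q ∈ boxes ρ × q ≢ p
    ∈-deleteBox⁻ {c , k} q∈ with 0<c , c≤ ← ∈-boxes⁻ (deleteBox p ρ) q∈ | k Fin.≟ row p
    ... | no k≢    = ∈-boxes⁺ ρ 0<c (subst (c ≤_) (lookup∘updateAt′ k _ {pred} k≢ ρ) c≤)
                   , k≢ ∘ cong row
    ... | yes refl = ∈-boxes⁺ ρ 0<c (ℕ.≤-trans c≤pred ℕ.pred[n]≤n)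
                   , λ q≡p → ℕ.<-irrefl (trans (cong column q≡p) p-last) (c<ρₖ 0<c c≤pred)
      where
      c≤pred : c ≤ pred (lookup ρ k)
      c≤pred = subst (c ≤_) (lookup∘updateAt k {pred} ρ) c≤

      -- As `pred 0` is 0, an empty row has to be excluded by the positivity of the column.
      c<ρₖ : ∀ {c r} → 0 < c → c ≤ pred r → c < r
      c<ρₖ {r = zero}  0<c c≤0 = contradiction (ℕ.<-≤-trans 0<c c≤0) ℕ.n≮0
      c<ρₖ {r = suc _} _   c≤r = s≤s c≤r

-- Dimension pairs

∈-D⁺ : ∀ (T : Placement n ℓ) {a j} → DimensionPair T a j → a ∈ D T j
∈-D⁺ T {j = j} = ∈-filter⁺ (λ a → dimensionPair? T a j) (∈-allFin _)

∈-D⁻ : ∀ (T : Placement n ℓ) {a j} → a ∈ D T j → DimensionPair T a j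
∈-D⁻ T {j = j} = proj₂ ∘ ∈-filter⁻ (λ a → dimensionPair? T a j) {xs = allFin _}

D-unique : ∀ (T : Placement n ℓ) j → Unique (D T j)
D-unique T j = Unique.filter⁺ _ (Unique.allFin⁺ _)

-- The pairs are regrouped by their larger entry `j`; the block of `j` is a copy of `D T j`.
length-dimensionPairs : ∀ (T : Placement n ℓ) →
  length (dimensionPairs T) ≡ Vec.sum (Vec.tabulate (length ∘ D T))
length-dimensionPairs {n} T = begin
  length (dimensionPairs T)                     ≡⟨ ↭-length (unique∧set⇒↭ pairs! byLarger! to from) ⟩
  length (concatMap pairsWith (allFin n))       ≡⟨ length-concatMap-tabulate pairsWith id ⟩
  Vec.sum (Vec.tabulate (length ∘ pairsWith))   ≡⟨ cong Vec.sum (tabulate-cong λ j → length-map _ (D T j)) ⟩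
  Vec.sum (Vec.tabulate (length ∘ D T))         ∎
  where
  open ≡-Reasoning

  isPair? = λ ((a , b) : Fin n × Fin n) → dimensionPair? T a b

  pairsWith : Fin n → List (Fin n × Fin n)
  pairsWith j = List.map (_, j) (D T j)

  pairs! : Unique (dimensionPairs T)
  pairs! = Unique.filter⁺ isPair? (Unique.cartesianProduct⁺ (Unique.allFin⁺ n) (Unique.allFin⁺ n))

  byLarger! : Unique (concatMap pairsWith (allFin n))
  byLarger! = concatMap-unique pairsWith proj₂
    (λ j → Unique.map⁺ (cong proj₁) (D-unique T j))
    (λ y∈ → cong proj₂ (proj₂ (proj₂ (∈-map⁻ _ y∈))))
    (Unique.allFin⁺ n)

  to : ∀ {x} → x ∈ dimensionPairs T → x ∈ concatMap pairsWith (allFin n)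
  to x∈ = ∈-concatMap⁺ pairsWith (lose (∈-allFin _)
    (∈-map⁺ _ (∈-D⁺ T (proj₂ (∈-filter⁻ isPair? {xs = cartesianProduct (allFin n) (allFin n)} x∈)))))

  from : ∀ {x} → x ∈ concatMap pairsWith (allFin n) → x ∈ dimensionPairs T
  from x∈
    with _ , _ , x∈j ← find (∈-concatMap⁻ pairsWith {xs = allFin n} x∈)
    with _ , a∈ , refl ← ∈-map⁻ _ x∈j =
    ∈-filter⁺ isPair? (∈-cartesianProduct⁺ (∈-allFin _) (∈-allFin _)) (∈-D⁻ T a∈)

-- The degree omits the number 1, which has no variable. Nothing is lost, because 1 is never the
-- larger entry of a pair.
length-dimensionPairs≡degree-Φ : ∀ (T : Placement n ℓ) →
                                 length (dimensionPairs T) ≡ degree n (Φ T)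
length-dimensionPairs≡degree-Φ {zero}  T = refl
length-dimensionPairs≡degree-Φ {suc n} T =
  trans (length-dimensionPairs T) (cong (λ d → length d + degree (suc n) (Φ T)) D₁≡[])
  where
  D₁≡[] : D T zero ≡ []
  D₁≡[] = filter-none (λ a → dimensionPair? T a zero) {xs = allFin (suc n)}
    (All.universal (λ _ ()) _)

-- The new entry exceeds all others. It is therefore no first component of a pair with `j`, and as a
-- right neighbour in condition (3) it imposes no restriction.
D-∷ʳ-inject₁ : ∀ (T : Placement n ℓ) p j →
               length (D (T ∷ʳ p) (inject₁ j)) ≡ length (D T j)
D-∷ʳ-inject₁ T p j = sym (length-bijection (D-unique T j) (D-unique (T ∷ʳ p) (inject₁ j))
  Fin.inject₁-injective to from)
  where
  look = lookup-∷ʳ-inject₁ T p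

  inject₁-mono-≤ : ∀ {a b : Fin _} → a Fin.≤ b → inject₁ a Fin.≤ inject₁ b
  inject₁-mono-≤ {a} {b} = subst₂ _≤_ (sym (Fin.toℕ-inject₁ a)) (sym (Fin.toℕ-inject₁ b))

  to : ∀ {a} → a ∈ D T j → inject₁ a ∈ D (T ∷ʳ p) (inject₁ j)
  to {a} a∈ with a<j , ≺j , right ← ∈-D⁻ T a∈ = ∈-D⁺ (T ∷ʳ p)
    ( subst₂ _<_ (sym (Fin.toℕ-inject₁ a)) (sym (Fin.toℕ-inject₁ j)) a<j
    , subst₂ BelowOrLeft (sym (look j)) (sym (look a)) ≺j
    , right′ )
    where
    right′ : ∀ c → ImmediatelyRight (lookup (T ∷ʳ p) c) (lookup (T ∷ʳ p) (inject₁ a)) →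
             inject₁ j Fin.≤ c
    right′ c isRight with view c
    ... | ‵fromℕ     = Fin.≤fromℕ (inject₁ j)
    ... | ‵inject₁ c = inject₁-mono-≤ (right c (subst₂ ImmediatelyRight (look c) (look a) isRight))

  from : ∀ {b} → b ∈ D (T ∷ʳ p) (inject₁ j) → ∃ λ a → a ∈ D T j × b ≡ inject₁ a
  from {b} b∈ with b<j , ≺j , right ← ∈-D⁻ (T ∷ʳ p) b∈ | view b
  ... | ‵fromℕ     = contradiction b<j (ℕ.≤⇒≯ (Fin.≤fromℕ (inject₁ j)))
  ... | ‵inject₁ a = a , ∈-D⁺ T
    ( subst₂ _<_ (Fin.toℕ-inject₁ a) (Fin.toℕ-inject₁ j) b<j
    , subst₂ BelowOrLeft (look j) (look a) ≺j
    , λ c isRight → subst₂ _≤_ (Fin.toℕ-inject₁ j) (Fin.toℕ-inject₁ c)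
        (right (inject₁ c) (subst₂ ImmediatelyRight (sym (look c)) (sym (look a)) isRight)) )
    , refl

-- The old placement must be nonempty: the number 1 carries no variable, so appending it would add
-- no exponent.
Φ-∷ʳ : ∀ (T : Placement (suc m) ℓ) p →
       Φ (T ∷ʳ p) ≡ Φ T ∷ʳ length (D (T ∷ʳ p) (fromℕ (suc m)))
Φ-∷ʳ T p = trans (tabulate-∷ʳ (length ∘ D (T ∷ʳ p) ∘ suc))
  (cong (_∷ʳ length (D (T ∷ʳ p) (fromℕ _))) (tabulate-cong λ i → D-∷ʳ-inject₁ T p (suc i)))

-- Removing the largest entry

module _ {ρ : Composition ℓ} (T : Placement m ℓ) (p : Box ℓ)
         (filling : IsFilling ρ (T ∷ʳ p)) (rowStrict : RowStrict (T ∷ʳ p)) where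

  open IsFilling filling

  private
    U    = T ∷ʳ p
    N    = fromℕ m
    UN   = lookup-∷ʳ-fromℕ T p
    look = lookup-∷ʳ-inject₁ T p

    p∈boxes : p ∈ boxes ρ
    p∈boxes = subst (_∈ boxes ρ) UN (inside N)

    0<column-p : 0 < column p
    0<column-p = proj₁ (∈-boxes⁻ ρ p∈boxes)

  -- Otherwise the box to the right of `p` would hold an entry that row-strictness forces above the
  -- largest one.
  largest-at-row-end : column p ≡ lookup ρ (row p)
  largest-at-row-end with ℕ.m≤n⇒m<n∨m≡n (proj₂ (∈-boxes⁻ ρ p∈boxes))
  ... | inj₂ c≡ = c≡
  ... | inj₁ c<
    with a , Ua≡ ← surjective {suc (column p) , row p} (∈-boxes⁺ ρ (s≤s z≤n) c<) =
    contradiction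
      (rowStrict N a (trans (cong row UN) (sym (cong row Ua≡)))
        (subst₂ _<_ (sym (cong column UN)) (sym (cong column Ua≡)) ℕ.≤-refl))
      (ℕ.≤⇒≯ (Fin.≤fromℕ a))

  private
    p∈ordering : p ∈ dimensionOrdering ρ
    p∈ordering = ∈-dimensionOrdering⁺ ρ largest-at-row-end 0<column-p

    to : ∀ {a} → a ∈ D U N → lookup U a ∈ filter (_≺? p) (dimensionOrdering ρ)
    to {a} a∈ with _ , below , right ← ∈-D⁻ U a∈ =
      ∈-filter⁺ (_≺? p) (∈-dimensionOrdering⁺ ρ at-end (proj₁ Ua-bounds)) Ua≺p
      where
      Ua-bounds = ∈-boxes⁻ ρ (inside a)

      Ua≺p : lookup U a ≺ p
      Ua≺p = subst (lookup U a ≺_) UN below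

      -- A box immediately right of `a` precedes that of `a` in the dimension-ordering, whereas `p`
      -- comes after it.
      right-of-a≢p : (suc (column (lookup U a)) , row (lookup U a)) ≢ p
      right-of-a≢p eq = ≺-asym (subst (lookup U a ≺_) (sym eq) Ua≺p) (inj₂ ℕ.≤-refl)

      at-end : column (lookup U a) ≡ lookup ρ (row (lookup U a))
      at-end with ℕ.m≤n⇒m<n∨m≡n (proj₂ Ua-bounds)
      ... | inj₂ c≡ = c≡
      ... | inj₁ c<
        with c , Uc≡ ← surjective (∈-boxes⁺ ρ (s≤s z≤n) c<) =
        contradiction (trans (sym Uc≡) (trans (cong (lookup U) c≡N) UN)) right-of-a≢p
        where
        -- Condition (3) bounds a right neighbour of `a` from below by the largest entry, so it
        -- would sit in `p`.
        c≡N : c ≡ N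
        c≡N = Fin.≤-antisym (Fin.≤fromℕ c) (right c (cong row Uc≡ , cong column Uc≡))

    from : ∀ {q} → q ∈ filter (_≺? p) (dimensionOrdering ρ) → ∃ λ a → a ∈ D U N × q ≡ lookup U a
    from {q} q∈
      with q∈ordering , q≺p ← ∈-filter⁻ (_≺? p) {xs = dimensionOrdering ρ} q∈
      with c≡ρₖ , 0<c ← ∈-dimensionOrdering⁻ ρ q∈ordering
      with a , refl ← surjective {q} (∈-boxes⁺ ρ 0<c (ℕ.≤-reflexive c≡ρₖ)) =
      a , ∈-D⁺ U
        ( Fin.≤∧≢⇒< (Fin.≤fromℕ a) (λ a≡N → ≺-irrefl (trans (cong (lookup U) a≡N) UN) q≺p)
        , subst (q ≺_) (sym UN) q≺p
        , λ c isRight → contradiction (inside c) (right-outside c isRight) )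
      , refl
      where
      -- Condition (3) holds vacuously, since a far-right box has no right neighbour in `ρ`.
      right-outside : ∀ c → ImmediatelyRight (lookup U c) q → lookup U c ∉ boxes ρ
      right-outside c (row≡ , column≡) Uc∈ = ℕ.<-irrefl refl (ℕ.≤-trans
        (subst₂ (λ i k → i ≤ lookup ρ k) column≡ row≡ (proj₂ (∈-boxes⁻ ρ Uc∈)))
        (ℕ.≤-reflexive (sym c≡ρₖ)))

  -- Sending an entry to its box is a bijection from `D U N` onto the far-right boxes preceding `p`,
  -- and the label is one more than their number.
  boxLabelled-largest : boxLabelled (suc (length (D U N))) ρ ≡ just p
  boxLabelled-largest = trans
    (cong (λ i → boxLabelled (suc i) ρ)
      (length-bijection (D-unique U N) (Unique.filter⁺ _ (dimensionOrdering-unique ρ))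
        injective to from))
    (boxLabelled-predecessors ρ p∈ordering)

  -- Injectivity keeps the smaller entries out of `p`, and `p` is the only box lost.
  isFilling-removeLargest : IsFilling (deleteBox p ρ) T
  isFilling-removeLargest = record
    { inside     = λ a → ∈-deleteBox⁺ ρ largest-at-row-end
        (subst (_∈ boxes ρ) (look a) (inside (inject₁ a)))
        λ Ta≡p → Fin.fromℕ≢inject₁ (injective (trans UN (sym (trans (look a) Ta≡p))))
    ; injective  = λ {a} {b} Ta≡Tb →
        Fin.inject₁-injective (injective (trans (look a) (trans Ta≡Tb (sym (look b)))))
    ; surjective = surjective′
    }
    where
    surjective′ : ∀ {q} → q ∈ boxes (deleteBox p ρ) → ∃ λ a → lookup T a ≡ q
    surjective′ q∈
      with q∈ρ , q≢p ← ∈-deleteBox⁻ ρ largest-at-row-end q∈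
      with a , Ua≡q ← surjective q∈ρ
      with view a
    ... | ‵fromℕ     = contradiction (trans (sym Ua≡q) UN) q≢p
    ... | ‵inject₁ a = a , trans (sym (look a)) Ua≡q

  rowStrict-removeLargest : RowStrict T
  rowStrict-removeLargest a b row≡ column< =
    subst₂ _<_ (Fin.toℕ-inject₁ a) (Fin.toℕ-inject₁ b)
      (rowStrict (inject₁ a) (inject₁ b)
        (subst₂ (λ x y → row x ≡ row y) (sym (look a)) (sym (look b)) row≡)
        (subst₂ (λ x y → column x < column y) (sym (look a)) (sym (look b)) column<))

-- Replaying the procedure on the monomial of a filling

boxes-single : ∀ {ρ : Composition ℓ} {p} → IsFilling ρ (p ∷ []) → boxes ρ ≡ p ∷ []
boxes-single {ρ = ρ} {p} filling = ↭-singleton-inv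
  (unique∧set⇒↭ (boxes-unique ρ) ([] ∷ []) only-p λ where (here refl) → inside zero)
  where
  open IsFilling filling

  only-p : ∀ {q} → q ∈ boxes ρ → q ∈ p ∷ []
  only-p q∈ with zero , refl ← surjective q∈ = here refl

-- Keeping the exponent vector in the form `α ∷ʳ d` lets `last` and `init` be rewritten to `d` and
-- `α`.
procedure-∷ʳ : ∀ (α : Monomial (suc m)) d {ρ : Composition ℓ} {p T} →
               boxLabelled (suc d) ρ ≡ just p →
               procedure (suc m) α (deleteBox p ρ) ≡ just T →
               procedure (suc (suc m)) (α ∷ʳ d) ρ ≡ just (T ∷ʳ p)
procedure-∷ʳ α d p-labelled T-rest
  rewrite last-∷ʳ d α | init-∷ʳ d α | p-labelled | T-rest = refl

-- Induction on the number of entries, over arbitrary compositions because deleting a far-right box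
-- can destroy the partition shape.
procedure-Φ-suc : ∀ m {ρ : Composition ℓ} (T : Placement (suc m) ℓ) →
                  IsFilling ρ T → RowStrict T → procedure (suc m) (Φ T) ρ ≡ just T
-- `remainingBox` matches on the list of boxes itself, so the base case needs this list exactly.
procedure-Φ-suc zero    (p ∷ []) filling rowStrict rewrite boxes-single filling = refl
procedure-Φ-suc (suc m) {ρ} T    filling rowStrict with T′ , p , refl ← initLast T =
  trans (cong (λ α → procedure (suc (suc m)) α ρ) (Φ-∷ʳ T′ p))
    (procedure-∷ʳ (Φ T′) _
      (boxLabelled-largest T′ p filling rowStrict)
      (procedure-Φ-suc m T′ (isFilling-removeLargest T′ p filling rowStrict)
        (rowStrict-removeLargest T′ p filling rowStrict)))

procedure-Φ : ∀ {ρ : Composition ℓ} (T : Placement n ℓ) →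
              IsFilling ρ T → RowStrict T → procedure n (Φ T) ρ ≡ just T
procedure-Φ {n = zero}  [] _       _         = refl
procedure-Φ {n = suc m} T  filling rowStrict = procedure-Φ-suc m T filling rowStrict

mainTheorem5 : ∀ {n ℓ} (μ : Composition ℓ) → IsPartition n μ →
    (∀ (α : Monomial n) (r : ℕ) → 𝒜 n μ α → degree n α ≡ r →
    ∃ λ (T : Placement n ℓ) →
    procedure n α μ ≡ just T
    × IsFilling μ T
    × RowStrict T
    × length (dimensionPairs T) ≡ r
    × Φ T ≡ α)
    ×
    (Σ ((α : Monomial n) → 𝒜 n μ α → RowStrictFilling n μ) λ Ψ →
    ∀ (α : Monomial n) (α∈𝒜 : 𝒜 n μ α) →
    let T = RowStrictFilling.placement (Ψ α α∈𝒜) in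
    procedure n α μ ≡ just T
    × length (dimensionPairs T) ≡ degree n α
    × Φ T ≡ α)
mainTheorem5 μ _ =
    (λ { _ _ (T , refl) refl → let open RowStrictFilling T in
         placement , procedure-Φ placement isFilling rowStrict , isFilling , rowStrict
       , length-dimensionPairs≡degree-Φ placement , refl })
  -- The filling that witnesses membership in `𝒜` serves as the value of `Ψ`. It agrees with the
  -- output of the procedure, so its placement depends on `α` alone and not on the witness.
  , (λ _ → proj₁)
  , λ { _ (T , refl) → let open RowStrictFilling T in
        procedure-Φ placement isFilling rowStrict
      , length-dimensionPairs≡degree-Φ placement , refl }
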